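{- For any term $\vdash C : \mathsf{Nat}$ in PCF, there is a term of finitary HEPCF $C_f \triangleq \mathtt{let}~a = [\![C]\!]~\mathtt{in}~(a~())$ such that $\vdash_E C_f : \mathsf{Unit}$ and $ET(C_f)$ represents the normal form of $C$ (if it exists; otherwise $ET(C_f) \equiv \bot$).
   Context: PCF here is fine-grained call-by-value PCF with a type $\mathsf{Nat}$ ($0$, $\mathtt{succ}(V)$, $\mathtt{case}(V;0 \mapsto C;\mathtt{succ}(x)\mapsto D)$) and fixpoints. HEPCF is the call-by-value calculus with finite base types only, algebraic operations, and (deep) effect handlers $\mathtt{handle}_H~C$, whose handler clauses $\sigma_i(x;r) \mapsto C_i$ receive the continuation $r$ and whose computations are typed $\Gamma \vdash_E C : T$ with $E$ the set of available effects. Fix $E = \{\sigma : \mathsf{Unit} \rightsquigarrow 1\}$. The translation $[\![\cdot]\!]$ from PCF to HEPCF sets $[\![\mathsf{Nat}]\!] = \mathsf{Unit} \rightarrow_E \mathsf{Unit}$, $[\![T \rightarrow U]\!] = [\![T]\!] \rightarrow_E [\![U]\!]$, $[\![0]\!] = \lambda x.\mathtt{return}(())$, $[\![\mathtt{succ}(V)]\!] = \lambda x.\sigma(y.[\![V]\!]~())$, is homomorphic on the other constructs, and translates $\mathtt{case}$ by handling the thunk $[\![V]\!]~()$ with a deep handler that returns a pair (encoded as a function) of a copy of the number and the chosen branch; thus a natural number $n$ is represented by a thunk whose effect tree is $n$ nested $\sigma$ nodes ending in $\mathtt{return}(())$. $ET$ denotes the effect tree of a closed computation; "represents the normal form" means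 $ET(C_f)$ is this tree encoding of the natural number computed by $C$. -}

module Defs where

open import Data.Nat using (ℕ; zero; suc)
open import Data.List using (List; []; _∷_)
open import Data.Product using (Σ; _×_; _,_)
open import Relation.Nullary using (¬_)
open import Relation.Binary.Construct.Closure.ReflexiveTransitive using (Star)

Ren : Set
Ren = ℕ → ℕ

liftR : Ren → Ren
liftR ρ zero    = zero
liftR ρ (suc i) = suc (ρ i)

data _∋_∶_ {T : Set} : List T → ℕ → T → Set where
  here  : ∀ {Γ A} → (A ∷ Γ) ∋ zero ∶ A
  there : ∀ {Γ A B i} → Γ ∋ i ∶ A → (B ∷ Γ) ∋ suc i ∶ A

data PTy : Set where
  Nat  : PTy
  _⇒_  : PTy → PTy → PTy

mutual
  data PVal : Set where
    var  : ℕ → PVal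
    zero : PVal
    succ : PVal → PVal
    lam  : PComp → PVal
    rec  : PComp → PVal          -- fix f.λx.C     (x = var 0, f = var 1 in C)

  data PComp : Set where
    return : PVal → PComp
    lett   : PComp → PComp → PComp
    app    : PVal → PVal → PComp
    case   : PVal → PComp → PComp → PComp   -- case(V; 0 ↦ C; succ(x) ↦ D)  (x = var 0 in D)

PCtx : Set
PCtx = List PTy

mutual
  data _⊢pv_∶_ (Γ : PCtx) : PVal → PTy → Set where
    tvar  : ∀ {i A} → Γ ∋ i ∶ A → Γ ⊢pv var i ∶ A
    tzero : Γ ⊢pv zero ∶ Nat
    tsucc : ∀ {V} → Γ ⊢pv V ∶ Nat → Γ ⊢pv succ V ∶ Nat
    tlam  : ∀ {A B C} → (A ∷ Γ) ⊢pc C ∶ B → Γ ⊢pv lam C ∶ (A ⇒ B)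
    trec  : ∀ {A B C} → (A ∷ (A ⇒ B) ∷ Γ) ⊢pc C ∶ B → Γ ⊢pv rec C ∶ (A ⇒ B)

  data _⊢pc_∶_ (Γ : PCtx) : PComp → PTy → Set where
    treturn : ∀ {V A} → Γ ⊢pv V ∶ A → Γ ⊢pc return V ∶ A
    tlet    : ∀ {C D A B} → Γ ⊢pc C ∶ A → (A ∷ Γ) ⊢pc D ∶ B → Γ ⊢pc lett C D ∶ B
    tapp    : ∀ {V W A B} → Γ ⊢pv V ∶ (A ⇒ B) → Γ ⊢pv W ∶ A → Γ ⊢pc app V W ∶ B
    tcase   : ∀ {V C D B} → Γ ⊢pv V ∶ Nat → Γ ⊢pc C ∶ B → (Nat ∷ Γ) ⊢pc D ∶ B
            → Γ ⊢pc case V C D ∶ B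

mutual
  renPV : Ren → PVal → PVal
  renPV ρ (var i)  = var (ρ i)
  renPV ρ zero     = zero
  renPV ρ (succ V) = succ (renPV ρ V)
  renPV ρ (lam C)  = lam (renPC (liftR ρ) C)
  renPV ρ (rec C)  = rec (renPC (liftR (liftR ρ)) C)

  renPC : Ren → PComp → PComp
  renPC ρ (return V)   = return (renPV ρ V)
  renPC ρ (lett C D)   = lett (renPC ρ C) (renPC (liftR ρ) D)
  renPC ρ (app V W)    = app (renPV ρ V) (renPV ρ W)
  renPC ρ (case V C D) = case (renPV ρ V) (renPC ρ C) (renPC (liftR ρ) D)

PSub : Set
PSub = ℕ → PVal

liftPS : PSub → PSub
liftPS s zero    = var zero
liftPS s (suc i) = renPV suc (s i)

mutual
  subPV : PSub → PVal → PVal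
  subPV s (var i)  = s i
  subPV s zero     = zero
  subPV s (succ V) = succ (subPV s V)
  subPV s (lam C)  = lam (subPC (liftPS s) C)
  subPV s (rec C)  = rec (subPC (liftPS (liftPS s)) C)

  subPC : PSub → PComp → PComp
  subPC s (return V)   = return (subPV s V)
  subPC s (lett C D)   = lett (subPC s C) (subPC (liftPS s) D)
  subPC s (app V W)    = app (subPV s V) (subPV s W)
  subPC s (case V C D) = case (subPV s V) (subPC s C) (subPC (liftPS s) D)

_[_]p : PComp → PVal → PComp
C [ V ]p = subPC (λ { zero → V ; (suc i) → var i }) C

_[_∣_]p : PComp → PVal → PVal → PComp
C [ V ∣ W ]p = subPC (λ { zero → V ; (suc zero) → W ; (suc (suc i)) → var i }) C

data _⟶p_ : PComp → PComp → Set where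
  β-let   : ∀ {V D} → lett (return V) D ⟶p (D [ V ]p)
  ξ-let   : ∀ {C C′ D} → C ⟶p C′ → lett C D ⟶p lett C′ D
  β-lam   : ∀ {C V} → app (lam C) V ⟶p (C [ V ]p)
  β-rec   : ∀ {C V} → app (rec C) V ⟶p (C [ V ∣ rec C ]p)
  β-zero  : ∀ {C D} → case zero C D ⟶p C
  β-succ  : ∀ {V C D} → case (succ V) C D ⟶p (D [ V ]p)

_⟶p*_ : PComp → PComp → Set
_⟶p*_ = Star _⟶p_

num : ℕ → PVal
num zero    = zero
num (suc n) = succ (num n)

-- HEPCF, specialised to the single effect signature E = {σ : Unit ⇝ 1}.
-- Every arrow is A →_E B and every computation judgement is Γ ⊢_E C : B.

data HTy : Set where
  Unit : HTy
  _⇒_  : HTy → HTy → HTy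

mutual
  data HVal : Set where
    var  : ℕ → HVal
    unit : HVal
    lam  : HComp → HVal
    rec  : HComp → HVal           -- fix f.λx.C  (x = var 0, f = var 1)

  data HComp : Set where
    return : HVal → HComp
    lett   : HComp → HComp → HComp
    app    : HVal → HVal → HComp
    op     : HVal → HComp → HComp            -- σ(V; y.C)      (y = var 0 in C)
    handle : HComp → HComp → HComp → HComp
      -- handle C with { return(x) ↦ Cr ; σ(x; r) ↦ Cs }
      -- x = var 0 in Cr ;  r = var 0, x = var 1 in Cs   (deep handler)

HCtx : Set
HCtx = List HTy

mutual
  data _⊢hv_∶_ (Γ : HCtx) : HVal → HTy → Set where
    tvar  : ∀ {i A} → Γ ∋ i ∶ A → Γ ⊢hv var i ∶ A
    tunit : Γ ⊢hv unit ∶ Unit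
    tlam  : ∀ {A B C} → (A ∷ Γ) ⊢hc C ∶ B → Γ ⊢hv lam C ∶ (A ⇒ B)
    trec  : ∀ {A B C} → (A ∷ (A ⇒ B) ∷ Γ) ⊢hc C ∶ B → Γ ⊢hv rec C ∶ (A ⇒ B)

  data _⊢hc_∶_ (Γ : HCtx) : HComp → HTy → Set where
    treturn : ∀ {V A} → Γ ⊢hv V ∶ A → Γ ⊢hc return V ∶ A
    tlet    : ∀ {C D A B} → Γ ⊢hc C ∶ A → (A ∷ Γ) ⊢hc D ∶ B → Γ ⊢hc lett C D ∶ B
    tapp    : ∀ {V W A B} → Γ ⊢hv V ∶ (A ⇒ B) → Γ ⊢hv W ∶ A → Γ ⊢hc app V W ∶ B
    top     : ∀ {V C B} → Γ ⊢hv V ∶ Unit → (Unit ∷ Γ) ⊢hc C ∶ B → Γ ⊢hc op V C ∶ B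
    thandle : ∀ {C Cr Cs A B}
            → Γ ⊢hc C ∶ A
            → (A ∷ Γ) ⊢hc Cr ∶ B
            → ((Unit ⇒ B) ∷ Unit ∷ Γ) ⊢hc Cs ∶ B
            → Γ ⊢hc handle C Cr Cs ∶ B

mutual
  renHV : Ren → HVal → HVal
  renHV ρ (var i) = var (ρ i)
  renHV ρ unit    = unit
  renHV ρ (lam C) = lam (renHC (liftR ρ) C)
  renHV ρ (rec C) = rec (renHC (liftR (liftR ρ)) C)

  renHC : Ren → HComp → HComp
  renHC ρ (return V)        = return (renHV ρ V)
  renHC ρ (lett C D)        = lett (renHC ρ C) (renHC (liftR ρ) D)
  renHC ρ (app V W)         = app (renHV ρ V) (renHV ρ W)
  renHC ρ (op V C)          = op (renHV ρ V) (renHC (liftR ρ) C)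
  renHC ρ (handle C Cr Cs)  = handle (renHC ρ C) (renHC (liftR ρ) Cr) (renHC (liftR (liftR ρ)) Cs)

HSub : Set
HSub = ℕ → HVal

liftHS : HSub → HSub
liftHS s zero    = var zero
liftHS s (suc i) = renHV suc (s i)

mutual
  subHV : HSub → HVal → HVal
  subHV s (var i) = s i
  subHV s unit    = unit
  subHV s (lam C) = lam (subHC (liftHS s) C)
  subHV s (rec C) = rec (subHC (liftHS (liftHS s)) C)

  subHC : HSub → HComp → HComp
  subHC s (return V)       = return (subHV s V)
  subHC s (lett C D)       = lett (subHC s C) (subHC (liftHS s) D)
  subHC s (app V W)        = app (subHV s V) (subHV s W)
  subHC s (op V C)         = op (subHV s V) (subHC (liftHS s) C)
  subHC s (handle C Cr Cs) = handle (subHC s C) (subHC (liftHS s) Cr) (subHC (liftHS (liftHS s)) Cs)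

_[_]h : HComp → HVal → HComp
C [ V ]h = subHC (λ { zero → V ; (suc i) → var i }) C

_[_∣_]h : HComp → HVal → HVal → HComp
C [ V ∣ W ]h = subHC (λ { zero → V ; (suc zero) → W ; (suc (suc i)) → var i }) C

-- small-step reduction; an operation σ(V; y.C) not enclosed in a handler is
-- a terminal (stuck) configuration, floated outwards through let.
data _⟶h_ : HComp → HComp → Set where
  β-let    : ∀ {V D} → lett (return V) D ⟶h (D [ V ]h)
  ξ-let    : ∀ {C C′ D} → C ⟶h C′ → lett C D ⟶h lett C′ D
  op-let   : ∀ {V C D} → lett (op V C) D ⟶h op V (lett C (renHC (liftR suc) D))
  β-lam    : ∀ {C V} → app (lam C) V ⟶h (C [ V ]h)
  β-rec    : ∀ {C V} → app (rec C) V ⟶h (C [ V ∣ rec C ]h)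
  β-hret   : ∀ {V Cr Cs} → handle (return V) Cr Cs ⟶h (Cr [ V ]h)
  β-hop    : ∀ {V C Cr Cs}
           → handle (op V C) Cr Cs
             ⟶h (Cs [ lam (handle C (renHC (liftR suc) Cr) (renHC (liftR (liftR suc)) Cs)) ∣ V ]h)
  ξ-handle : ∀ {C C′ Cr Cs} → C ⟶h C′ → handle C Cr Cs ⟶h handle C′ Cr Cs

_⟶h*_ : HComp → HComp → Set
_⟶h*_ = Star _⟶h_

-- Effect trees for the signature {σ : Unit ⇝ 1}.
-- Only well-founded trees (finitely many σ-nodes) are represented.

data Tree : Set where
  leaf : HVal → Tree
  node : HVal → Tree → Tree
  ⊥t   : Tree

data _⟶h[_]_ : HComp → ℕ → HComp → Set where
  done : ∀ {C} → C ⟶h[ zero ] C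
  step : ∀ {C C′ C″ k} → C ⟶h C′ → C′ ⟶h[ k ] C″ → C ⟶h[ suc k ] C″

-- C diverges: it admits reduction sequences of every length (reduction is
-- deterministic, so this is an infinite reduction sequence)
Diverges : HComp → Set
Diverges C = (k : ℕ) → Σ HComp (λ C′ → C ⟶h[ k ] C′)

data ET_≡_ : HComp → Tree → Set where
  et-ret : ∀ {C V} → C ⟶h* return V → ET C ≡ leaf V
  et-op  : ∀ {C V C′ t} → C ⟶h* op V C′ → ET (C′ [ unit ]h) ≡ t → ET C ≡ node V t
  et-div : ∀ {C} → Diverges C → ET C ≡ ⊥t

natTree : ℕ → Tree
natTree zero    = leaf unit
natTree (suc n) = node unit (natTree n)

⟦_⟧ty : PTy → HTy
⟦ Nat ⟧ty   = Unit ⇒ Unit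
⟦ A ⇒ B ⟧ty = ⟦ A ⟧ty ⇒ ⟦ B ⟧ty

zeroH : HVal
zeroH = lam (return unit)

-- [[succ V]] = λx.σ((); y.[[V]] ())   given W = [[V]]  (shifted past x, y)
succH : HVal → HVal
succH W = lam (op unit (app (renHV (λ i → suc (suc i)) W) unit))

-- handler for case, result type P = ([[Nat]] → R) → (Unit → R) → R, where
-- the result applied to s and z calls  z ()  for 0  and  s (copy of n) for n+1.
-- return(x) ↦ return (λs. return (λz. z ()))
caseRet : HComp
caseRet = return (lam (return (lam (app (var 0) unit))))

-- σ(x; r) ↦ return (λs. return (λz. let q = r () in
--                                  let q1 = q (λa. s ([[succ]] a)) in
--                                  q1 (λ_. s [[0]])))
caseOp : HComp
caseOp = return (lam (return (lam
           (lett (app (var 2) unit)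
           (lett (app (var 0) (lam (app (var 3) (succH (var 0)))))
                 (app (var 0) (lam (app (var 4) zeroH))))))))

mutual
  ⟦_⟧v : PVal → HVal
  ⟦ var i ⟧v  = var i
  ⟦ zero ⟧v   = zeroH
  ⟦ succ V ⟧v = succH ⟦ V ⟧v
  ⟦ lam C ⟧v  = lam ⟦ C ⟧c
  ⟦ rec C ⟧v  = rec ⟦ C ⟧c

  ⟦_⟧c : PComp → HComp
  ⟦ return V ⟧c   = return ⟦ V ⟧v
  ⟦ lett C D ⟧c   = lett ⟦ C ⟧c ⟦ D ⟧c
  ⟦ app V W ⟧c    = app ⟦ V ⟧v ⟦ W ⟧v
  ⟦ case V C D ⟧c =
    -- let p = handle ([[V]] ()) with {caseRet; caseOp} in
    -- let f = p (λx.[[D]]) in f (λ_.[[C]])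
    lett (handle (app ⟦ V ⟧v unit) caseRet caseOp)
      (lett (app (var 0) (lam (renHC (liftR suc) ⟦ D ⟧c)))
            (app (var 0) (lam (renHC (λ i → suc (suc (suc i))) ⟦ C ⟧c))))

Cf : PComp → HComp
Cf C = lett ⟦ C ⟧c (app (var 0) unit)

-- ⟦_⟧ is a simulation: each PCF step becomes at least one HEPCF step. The only real work is
-- case(num n; C; D): the deep handler turns the thunk ⟦ num n ⟧v, a chain of n σ-operations,
-- into a selector that runs ⟦ C ⟧c for n = 0 and otherwise hands ⟦ D ⟧c a fresh copy of
-- ⟦ num (n - 1) ⟧v, rebuilt by handling the captured continuation again. So C ⟶p* return (num n)
-- gives Cf C ⟶h* ⟦ num n ⟧v (), whose effect tree is natTree n, while a PCF computation that
-- never returns produces HEPCF reduction sequences of every length.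

module Submission where

open import Defs
open import Data.Nat using (ℕ; zero; suc)
open import Data.List using (List; []; _∷_; map)
open import Data.Product using (Σ; _×_; _,_; proj₁; proj₂)
open import Data.Sum using (_⊎_; inj₁; inj₂)
open import Data.Empty using (⊥-elim)
open import Data.Nat.GeneralisedArithmetic using (iterate)
open import Function using (_∘_)
open import Relation.Nullary using (¬_)
open import Relation.Binary.PropositionalEquality
  using (_≡_; refl; sym; trans; cong; cong₂; subst)
open import Relation.Binary.Construct.Closure.ReflexiveTransitive using (ε; _◅_; _◅◅_)

cong₃ : ∀ {A B C D : Set} (f : A → B → C → D) {a a′ b b′ c c′} →
        a ≡ a′ → b ≡ b′ → c ≡ c′ → f a b c ≡ f a′ b′ c′
cong₃ f refl refl refl = refl

liftR-cong : ∀ {ρ ρ′ : Ren} → (∀ i → ρ i ≡ ρ′ i) → ∀ i → liftR ρ i ≡ liftR ρ′ i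
liftR-cong h zero    = refl
liftR-cong h (suc i) = cong suc (h i)

liftR-∘ : ∀ (ρ τ : Ren) i → liftR ρ (liftR τ i) ≡ liftR (ρ ∘ τ) i
liftR-∘ ρ τ zero    = refl
liftR-∘ ρ τ (suc i) = refl

liftR²-∘ : ∀ (ρ τ : Ren) i → liftR (liftR ρ) (liftR (liftR τ) i) ≡ liftR (liftR (ρ ∘ τ)) i
liftR²-∘ ρ τ i = trans (liftR-∘ (liftR ρ) (liftR τ) i) (liftR-cong (liftR-∘ ρ τ) i)

mutual
  renHV-cong : ∀ {ρ ρ′} → (∀ i → ρ i ≡ ρ′ i) → ∀ V → renHV ρ V ≡ renHV ρ′ V
  renHV-cong h (var i) = cong var (h i)
  renHV-cong h unit    = refl
  renHV-cong h (lam C) = cong lam (renHC-cong (liftR-cong h) C)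
  renHV-cong h (rec C) = cong rec (renHC-cong (liftR-cong (liftR-cong h)) C)

  renHC-cong : ∀ {ρ ρ′} → (∀ i → ρ i ≡ ρ′ i) → ∀ C → renHC ρ C ≡ renHC ρ′ C
  renHC-cong h (return V)       = cong return (renHV-cong h V)
  renHC-cong h (lett C D)       = cong₂ lett (renHC-cong h C) (renHC-cong (liftR-cong h) D)
  renHC-cong h (app V W)        = cong₂ app (renHV-cong h V) (renHV-cong h W)
  renHC-cong h (op V C)         = cong₂ op (renHV-cong h V) (renHC-cong (liftR-cong h) C)
  renHC-cong h (handle C Cr Cs) =
    cong₃ handle (renHC-cong h C) (renHC-cong (liftR-cong h) Cr) (renHC-cong (liftR-cong (liftR-cong h)) Cs)

mutual
  renHV-renHV : ∀ ρ τ V → renHV ρ (renHV τ V) ≡ renHV (ρ ∘ τ) V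
  renHV-renHV ρ τ (var i) = refl
  renHV-renHV ρ τ unit    = refl
  renHV-renHV ρ τ (lam C) = cong lam (trans (renHC-renHC _ _ C) (renHC-cong (liftR-∘ ρ τ) C))
  renHV-renHV ρ τ (rec C) = cong rec (trans (renHC-renHC _ _ C) (renHC-cong (liftR²-∘ ρ τ) C))

  renHC-renHC : ∀ ρ τ C → renHC ρ (renHC τ C) ≡ renHC (ρ ∘ τ) C
  renHC-renHC ρ τ (return V) = cong return (renHV-renHV ρ τ V)
  renHC-renHC ρ τ (lett C D) =
    cong₂ lett (renHC-renHC ρ τ C) (trans (renHC-renHC _ _ D) (renHC-cong (liftR-∘ ρ τ) D))
  renHC-renHC ρ τ (app V W)  = cong₂ app (renHV-renHV ρ τ V) (renHV-renHV ρ τ W)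
  renHC-renHC ρ τ (op V C)   =
    cong₂ op (renHV-renHV ρ τ V) (trans (renHC-renHC _ _ C) (renHC-cong (liftR-∘ ρ τ) C))
  renHC-renHC ρ τ (handle C Cr Cs) = cong₃ handle (renHC-renHC ρ τ C)
    (trans (renHC-renHC _ _ Cr) (renHC-cong (liftR-∘ ρ τ) Cr))
    (trans (renHC-renHC _ _ Cs) (renHC-cong (liftR²-∘ ρ τ) Cs))

liftHS-cong : ∀ {σ σ′ : HSub} → (∀ i → σ i ≡ σ′ i) → ∀ i → liftHS σ i ≡ liftHS σ′ i
liftHS-cong h zero    = refl
liftHS-cong h (suc i) = cong (renHV suc) (h i)

mutual
  subHV-cong : ∀ {σ σ′} → (∀ i → σ i ≡ σ′ i) → ∀ V → subHV σ V ≡ subHV σ′ V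
  subHV-cong h (var i) = h i
  subHV-cong h unit    = refl
  subHV-cong h (lam C) = cong lam (subHC-cong (liftHS-cong h) C)
  subHV-cong h (rec C) = cong rec (subHC-cong (liftHS-cong (liftHS-cong h)) C)

  subHC-cong : ∀ {σ σ′} → (∀ i → σ i ≡ σ′ i) → ∀ C → subHC σ C ≡ subHC σ′ C
  subHC-cong h (return V)       = cong return (subHV-cong h V)
  subHC-cong h (lett C D)       = cong₂ lett (subHC-cong h C) (subHC-cong (liftHS-cong h) D)
  subHC-cong h (app V W)        = cong₂ app (subHV-cong h V) (subHV-cong h W)
  subHC-cong h (op V C)         = cong₂ op (subHV-cong h V) (subHC-cong (liftHS-cong h) C)
  subHC-cong h (handle C Cr Cs) =
    cong₃ handle (subHC-cong h C) (subHC-cong (liftHS-cong h) Cr) (subHC-cong (liftHS-cong (liftHS-cong h)) Cs)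

liftHS-liftR : ∀ (σ : HSub) (ρ : Ren) i → liftHS σ (liftR ρ i) ≡ liftHS (σ ∘ ρ) i
liftHS-liftR σ ρ zero    = refl
liftHS-liftR σ ρ (suc i) = refl

liftHS²-liftR² : ∀ (σ : HSub) (ρ : Ren) i →
                 liftHS (liftHS σ) (liftR (liftR ρ) i) ≡ liftHS (liftHS (σ ∘ ρ)) i
liftHS²-liftR² σ ρ i = trans (liftHS-liftR (liftHS σ) (liftR ρ) i) (liftHS-cong (liftHS-liftR σ ρ) i)

mutual
  subHV-renHV : ∀ σ ρ V → subHV σ (renHV ρ V) ≡ subHV (σ ∘ ρ) V
  subHV-renHV σ ρ (var i) = refl
  subHV-renHV σ ρ unit    = refl
  subHV-renHV σ ρ (lam C) = cong lam (trans (subHC-renHC _ _ C) (subHC-cong (liftHS-liftR σ ρ) C))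
  subHV-renHV σ ρ (rec C) = cong rec (trans (subHC-renHC _ _ C) (subHC-cong (liftHS²-liftR² σ ρ) C))

  subHC-renHC : ∀ σ ρ C → subHC σ (renHC ρ C) ≡ subHC (σ ∘ ρ) C
  subHC-renHC σ ρ (return V) = cong return (subHV-renHV σ ρ V)
  subHC-renHC σ ρ (lett C D) =
    cong₂ lett (subHC-renHC σ ρ C) (trans (subHC-renHC _ _ D) (subHC-cong (liftHS-liftR σ ρ) D))
  subHC-renHC σ ρ (app V W)  = cong₂ app (subHV-renHV σ ρ V) (subHV-renHV σ ρ W)
  subHC-renHC σ ρ (op V C)   =
    cong₂ op (subHV-renHV σ ρ V) (trans (subHC-renHC _ _ C) (subHC-cong (liftHS-liftR σ ρ) C))
  subHC-renHC σ ρ (handle C Cr Cs) = cong₃ handle (subHC-renHC σ ρ C)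
    (trans (subHC-renHC _ _ Cr) (subHC-cong (liftHS-liftR σ ρ) Cr))
    (trans (subHC-renHC _ _ Cs) (subHC-cong (liftHS²-liftR² σ ρ) Cs))

liftR-liftHS : ∀ (ρ : Ren) (σ : HSub) i → renHV (liftR ρ) (liftHS σ i) ≡ liftHS (renHV ρ ∘ σ) i
liftR-liftHS ρ σ zero    = refl
liftR-liftHS ρ σ (suc i) = trans (renHV-renHV (liftR ρ) suc (σ i)) (sym (renHV-renHV suc ρ (σ i)))

liftR²-liftHS² : ∀ (ρ : Ren) (σ : HSub) i →
                 renHV (liftR (liftR ρ)) (liftHS (liftHS σ) i) ≡ liftHS (liftHS (renHV ρ ∘ σ)) i
liftR²-liftHS² ρ σ i = trans (liftR-liftHS (liftR ρ) (liftHS σ) i) (liftHS-cong (liftR-liftHS ρ σ) i)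

mutual
  renHV-subHV : ∀ ρ σ V → renHV ρ (subHV σ V) ≡ subHV (renHV ρ ∘ σ) V
  renHV-subHV ρ σ (var i) = refl
  renHV-subHV ρ σ unit    = refl
  renHV-subHV ρ σ (lam C) = cong lam (trans (renHC-subHC _ _ C) (subHC-cong (liftR-liftHS ρ σ) C))
  renHV-subHV ρ σ (rec C) = cong rec (trans (renHC-subHC _ _ C) (subHC-cong (liftR²-liftHS² ρ σ) C))

  renHC-subHC : ∀ ρ σ C → renHC ρ (subHC σ C) ≡ subHC (renHV ρ ∘ σ) C
  renHC-subHC ρ σ (return V) = cong return (renHV-subHV ρ σ V)
  renHC-subHC ρ σ (lett C D) =
    cong₂ lett (renHC-subHC ρ σ C) (trans (renHC-subHC _ _ D) (subHC-cong (liftR-liftHS ρ σ) D))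
  renHC-subHC ρ σ (app V W)  = cong₂ app (renHV-subHV ρ σ V) (renHV-subHV ρ σ W)
  renHC-subHC ρ σ (op V C)   =
    cong₂ op (renHV-subHV ρ σ V) (trans (renHC-subHC _ _ C) (subHC-cong (liftR-liftHS ρ σ) C))
  renHC-subHC ρ σ (handle C Cr Cs) = cong₃ handle (renHC-subHC ρ σ C)
    (trans (renHC-subHC _ _ Cr) (subHC-cong (liftR-liftHS ρ σ) Cr))
    (trans (renHC-subHC _ _ Cs) (subHC-cong (liftR²-liftHS² ρ σ) Cs))

renHV-comm : ∀ {ρ ρ′ τ τ′} → (∀ i → ρ′ (τ i) ≡ τ′ (ρ i)) →
             ∀ V → renHV ρ′ (renHV τ V) ≡ renHV τ′ (renHV ρ V)
renHV-comm {ρ} {ρ′} {τ} {τ′} h V =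
  trans (renHV-renHV ρ′ τ V) (trans (renHV-cong h V) (sym (renHV-renHV τ′ ρ V)))

renHC-comm : ∀ {ρ ρ′ τ τ′} → (∀ i → ρ′ (τ i) ≡ τ′ (ρ i)) →
             ∀ C → renHC ρ′ (renHC τ C) ≡ renHC τ′ (renHC ρ C)
renHC-comm {ρ} {ρ′} {τ} {τ′} h C =
  trans (renHC-renHC ρ′ τ C) (trans (renHC-cong h C) (sym (renHC-renHC τ′ ρ C)))

renHV-subHV-comm : ∀ {ρ σ σ′} → (∀ i → renHV ρ (σ i) ≡ σ′ (ρ i)) →
                   ∀ V → renHV ρ (subHV σ V) ≡ subHV σ′ (renHV ρ V)
renHV-subHV-comm {ρ} {σ} {σ′} h V =
  trans (renHV-subHV ρ σ V) (trans (subHV-cong h V) (sym (subHV-renHV σ′ ρ V)))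

renHC-subHC-comm : ∀ {ρ σ σ′} → (∀ i → renHV ρ (σ i) ≡ σ′ (ρ i)) →
                   ∀ C → renHC ρ (subHC σ C) ≡ subHC σ′ (renHC ρ C)
renHC-subHC-comm {ρ} {σ} {σ′} h C =
  trans (renHC-subHC ρ σ C) (trans (subHC-cong h C) (sym (subHC-renHC σ′ ρ C)))

TypedRen : {T : Set} → List T → List T → Ren → Set
TypedRen Γ Δ ρ = ∀ {i A} → Γ ∋ i ∶ A → Δ ∋ ρ i ∶ A

liftR-typed : ∀ {T : Set} {Γ Δ : List T} {ρ B} → TypedRen Γ Δ ρ → TypedRen (B ∷ Γ) (B ∷ Δ) (liftR ρ)
liftR-typed h here      = here
liftR-typed h (there p) = there (h p)

mutual
  renHV-⊢ : ∀ {Γ Δ ρ V A} → TypedRen Γ Δ ρ → Γ ⊢hv V ∶ A → Δ ⊢hv renHV ρ V ∶ A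
  renHV-⊢ h (tvar p) = tvar (h p)
  renHV-⊢ h tunit    = tunit
  renHV-⊢ h (tlam t) = tlam (renHC-⊢ (liftR-typed h) t)
  renHV-⊢ h (trec t) = trec (renHC-⊢ (liftR-typed (liftR-typed h)) t)

  renHC-⊢ : ∀ {Γ Δ ρ C A} → TypedRen Γ Δ ρ → Γ ⊢hc C ∶ A → Δ ⊢hc renHC ρ C ∶ A
  renHC-⊢ h (treturn t)     = treturn (renHV-⊢ h t)
  renHC-⊢ h (tlet t u)      = tlet (renHC-⊢ h t) (renHC-⊢ (liftR-typed h) u)
  renHC-⊢ h (tapp t u)      = tapp (renHV-⊢ h t) (renHV-⊢ h u)
  renHC-⊢ h (top t u)       = top (renHV-⊢ h t) (renHC-⊢ (liftR-typed h) u)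
  renHC-⊢ h (thandle t u v) =
    thandle (renHC-⊢ h t) (renHC-⊢ (liftR-typed h) u) (renHC-⊢ (liftR-typed (liftR-typed h)) v)

RenFixes : HCtx → Ren → Set
RenFixes Γ ρ = ∀ {i A} → Γ ∋ i ∶ A → ρ i ≡ i

liftR-fixes : ∀ {Γ ρ B} → RenFixes Γ ρ → RenFixes (B ∷ Γ) (liftR ρ)
liftR-fixes h here      = refl
liftR-fixes h (there p) = cong suc (h p)

mutual
  renHV-id : ∀ {Γ ρ V A} → RenFixes Γ ρ → Γ ⊢hv V ∶ A → renHV ρ V ≡ V
  renHV-id h (tvar p) = cong var (h p)
  renHV-id h tunit    = refl
  renHV-id h (tlam t) = cong lam (renHC-id (liftR-fixes h) t)
  renHV-id h (trec t) = cong rec (renHC-id (liftR-fixes (liftR-fixes h)) t)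

  renHC-id : ∀ {Γ ρ C A} → RenFixes Γ ρ → Γ ⊢hc C ∶ A → renHC ρ C ≡ C
  renHC-id h (treturn t)     = cong return (renHV-id h t)
  renHC-id h (tlet t u)      = cong₂ lett (renHC-id h t) (renHC-id (liftR-fixes h) u)
  renHC-id h (tapp t u)      = cong₂ app (renHV-id h t) (renHV-id h u)
  renHC-id h (top t u)       = cong₂ op (renHV-id h t) (renHC-id (liftR-fixes h) u)
  renHC-id h (thandle t u v) =
    cong₃ handle (renHC-id h t) (renHC-id (liftR-fixes h) u) (renHC-id (liftR-fixes (liftR-fixes h)) v)

SubFixes : HCtx → HSub → Set
SubFixes Γ σ = ∀ {i A} → Γ ∋ i ∶ A → σ i ≡ var i

liftHS-fixes : ∀ {Γ σ B} → SubFixes Γ σ → SubFixes (B ∷ Γ) (liftHS σ)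
liftHS-fixes h here      = refl
liftHS-fixes h (there p) = cong (renHV suc) (h p)

mutual
  subHV-id : ∀ {Γ σ V A} → SubFixes Γ σ → Γ ⊢hv V ∶ A → subHV σ V ≡ V
  subHV-id h (tvar p) = h p
  subHV-id h tunit    = refl
  subHV-id h (tlam t) = cong lam (subHC-id (liftHS-fixes h) t)
  subHV-id h (trec t) = cong rec (subHC-id (liftHS-fixes (liftHS-fixes h)) t)

  subHC-id : ∀ {Γ σ C A} → SubFixes Γ σ → Γ ⊢hc C ∶ A → subHC σ C ≡ C
  subHC-id h (treturn t)     = cong return (subHV-id h t)
  subHC-id h (tlet t u)      = cong₂ lett (subHC-id h t) (subHC-id (liftHS-fixes h) u)
  subHC-id h (tapp t u)      = cong₂ app (subHV-id h t) (subHV-id h u)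
  subHC-id h (top t u)       = cong₂ op (subHV-id h t) (subHC-id (liftHS-fixes h) u)
  subHC-id h (thandle t u v) =
    cong₃ handle (subHC-id h t) (subHC-id (liftHS-fixes h) u) (subHC-id (liftHS-fixes (liftHS-fixes h)) v)

Closed : HVal → Set
Closed V = (∀ σ → subHV σ V ≡ V) × (∀ ρ → renHV ρ V ≡ V)

⊢hv-closed : ∀ {V A} → [] ⊢hv V ∶ A → Closed V
⊢hv-closed t = (λ σ → subHV-id (λ ()) t) , (λ ρ → renHV-id (λ ()) t)

TypedPSub : PCtx → PCtx → PSub → Set
TypedPSub Γ Δ s = ∀ {i A} → Γ ∋ i ∶ A → Δ ⊢pv s i ∶ A

mutual
  renPV-⊢ : ∀ {Γ Δ ρ V A} → TypedRen Γ Δ ρ → Γ ⊢pv V ∶ A → Δ ⊢pv renPV ρ V ∶ A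
  renPV-⊢ h (tvar p)  = tvar (h p)
  renPV-⊢ h tzero     = tzero
  renPV-⊢ h (tsucc t) = tsucc (renPV-⊢ h t)
  renPV-⊢ h (tlam t)  = tlam (renPC-⊢ (liftR-typed h) t)
  renPV-⊢ h (trec t)  = trec (renPC-⊢ (liftR-typed (liftR-typed h)) t)

  renPC-⊢ : ∀ {Γ Δ ρ C A} → TypedRen Γ Δ ρ → Γ ⊢pc C ∶ A → Δ ⊢pc renPC ρ C ∶ A
  renPC-⊢ h (treturn t)   = treturn (renPV-⊢ h t)
  renPC-⊢ h (tlet t u)    = tlet (renPC-⊢ h t) (renPC-⊢ (liftR-typed h) u)
  renPC-⊢ h (tapp t u)    = tapp (renPV-⊢ h t) (renPV-⊢ h u)
  renPC-⊢ h (tcase t u v) = tcase (renPV-⊢ h t) (renPC-⊢ h u) (renPC-⊢ (liftR-typed h) v)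

liftPS-typed : ∀ {Γ Δ s B} → TypedPSub Γ Δ s → TypedPSub (B ∷ Γ) (B ∷ Δ) (liftPS s)
liftPS-typed h here      = tvar here
liftPS-typed h (there p) = renPV-⊢ there (h p)

mutual
  subPV-⊢ : ∀ {Γ Δ s V A} → TypedPSub Γ Δ s → Γ ⊢pv V ∶ A → Δ ⊢pv subPV s V ∶ A
  subPV-⊢ h (tvar p)  = h p
  subPV-⊢ h tzero     = tzero
  subPV-⊢ h (tsucc t) = tsucc (subPV-⊢ h t)
  subPV-⊢ h (tlam t)  = tlam (subPC-⊢ (liftPS-typed h) t)
  subPV-⊢ h (trec t)  = trec (subPC-⊢ (liftPS-typed (liftPS-typed h)) t)

  subPC-⊢ : ∀ {Γ Δ s C A} → TypedPSub Γ Δ s → Γ ⊢pc C ∶ A → Δ ⊢pc subPC s C ∶ A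
  subPC-⊢ h (treturn t)   = treturn (subPV-⊢ h t)
  subPC-⊢ h (tlet t u)    = tlet (subPC-⊢ h t) (subPC-⊢ (liftPS-typed h) u)
  subPC-⊢ h (tapp t u)    = tapp (subPV-⊢ h t) (subPV-⊢ h u)
  subPC-⊢ h (tcase t u v) = tcase (subPV-⊢ h t) (subPC-⊢ h u) (subPC-⊢ (liftPS-typed h) v)

[]p-⊢ : ∀ {A B C V} → (A ∷ []) ⊢pc C ∶ B → [] ⊢pv V ∶ A → [] ⊢pc C [ V ]p ∶ B
[]p-⊢ t v = subPC-⊢ (λ { here → v ; (there ()) }) t

[∣]p-⊢ : ∀ {A A′ B C V W} → (A ∷ A′ ∷ []) ⊢pc C ∶ B → [] ⊢pv V ∶ A → [] ⊢pv W ∶ A′ →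
         [] ⊢pc C [ V ∣ W ]p ∶ B
[∣]p-⊢ t v w = subPC-⊢ (λ { here → v ; (there here) → w ; (there (there ())) }) t

preservation : ∀ {C C′ A} → [] ⊢pc C ∶ A → C ⟶p C′ → [] ⊢pc C′ ∶ A
preservation (tlet (treturn v) u)  β-let    = []p-⊢ u v
preservation (tlet t u)            (ξ-let r) = tlet (preservation t r) u
preservation (tapp (tlam t) v)     β-lam    = []p-⊢ t v
preservation (tapp (trec t) v)     β-rec    = [∣]p-⊢ t v (trec t)
preservation (tcase _ u _)         β-zero   = u
preservation (tcase (tsucc w) _ v) β-succ   = []p-⊢ v w

preservation* : ∀ {C C′ A} → [] ⊢pc C ∶ A → C ⟶p* C′ → [] ⊢pc C′ ∶ A
preservation* t ε        = t
preservation* t (r ◅ rs) = preservation* (preservation t r) rs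

progress : ∀ {C A} → [] ⊢pc C ∶ A → (Σ PVal λ V → C ≡ return V) ⊎ (Σ PComp λ C′ → C ⟶p C′)
progress (treturn _) = inj₁ (_ , refl)
progress (tlet t u) with progress t
... | inj₁ (V , refl) = inj₂ (_ , β-let)
... | inj₂ (C′ , r)   = inj₂ (_ , ξ-let r)
progress (tapp (tvar ()) _)
progress (tapp (tlam _) _)      = inj₂ (_ , β-lam)
progress (tapp (trec _) _)      = inj₂ (_ , β-rec)
progress (tcase (tvar ()) _ _)
progress (tcase tzero _ _)      = inj₂ (_ , β-zero)
progress (tcase (tsucc _) _ _)  = inj₂ (_ , β-succ)

canonical-Nat : ∀ {V} → [] ⊢pv V ∶ Nat → Σ ℕ λ n → V ≡ num n
canonical-Nat (tvar ())
canonical-Nat tzero = zero , refl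
canonical-Nat (tsucc t) with canonical-Nat t
... | n , refl = suc n , refl

num-⊢ : ∀ n → [] ⊢pv num n ∶ Nat
num-⊢ zero    = tzero
num-⊢ (suc n) = tsucc (num-⊢ n)

⟦_⟧ctx : PCtx → HCtx
⟦ Γ ⟧ctx = map ⟦_⟧ty Γ

⟦⟧-∋ : ∀ {Γ i A} → Γ ∋ i ∶ A → ⟦ Γ ⟧ctx ∋ i ∶ ⟦ A ⟧ty
⟦⟧-∋ here      = here
⟦⟧-∋ (there p) = there (⟦⟧-∋ p)

succH-⊢ : ∀ {Γ W} → Γ ⊢hv W ∶ ⟦ Nat ⟧ty → Γ ⊢hv succH W ∶ ⟦ Nat ⟧ty
succH-⊢ t = tlam (top tunit (tapp (renHV-⊢ (there ∘ there) t) tunit))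

CaseTy : HTy → HTy
CaseTy R = (⟦ Nat ⟧ty ⇒ R) ⇒ ((Unit ⇒ R) ⇒ R)

caseRet-⊢ : ∀ {Γ R} → (Unit ∷ Γ) ⊢hc caseRet ∶ CaseTy R
caseRet-⊢ = treturn (tlam (treturn (tlam (tapp (tvar here) tunit))))

caseOp-⊢ : ∀ {Γ R} → ((Unit ⇒ CaseTy R) ∷ Unit ∷ Γ) ⊢hc caseOp ∶ CaseTy R
caseOp-⊢ = treturn (tlam (treturn (tlam
  (tlet (tapp (tvar (there (there here))) tunit)
  (tlet (tapp (tvar here) (tlam (tapp (tvar (there (there (there here)))) (succH-⊢ (tvar here)))))
        (tapp (tvar here) (tlam (tapp (tvar (there (there (there (there here))))) (tlam (treturn tunit))))))))))

mutual
  ⟦⟧v-⊢ : ∀ {Γ V A} → Γ ⊢pv V ∶ A → ⟦ Γ ⟧ctx ⊢hv ⟦ V ⟧v ∶ ⟦ A ⟧ty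
  ⟦⟧v-⊢ (tvar p)  = tvar (⟦⟧-∋ p)
  ⟦⟧v-⊢ tzero     = tlam (treturn tunit)
  ⟦⟧v-⊢ (tsucc t) = succH-⊢ (⟦⟧v-⊢ t)
  ⟦⟧v-⊢ (tlam t)  = tlam (⟦⟧c-⊢ t)
  ⟦⟧v-⊢ (trec t)  = trec (⟦⟧c-⊢ t)

  ⟦⟧c-⊢ : ∀ {Γ C A} → Γ ⊢pc C ∶ A → ⟦ Γ ⟧ctx ⊢hc ⟦ C ⟧c ∶ ⟦ A ⟧ty
  ⟦⟧c-⊢ (treturn t)   = treturn (⟦⟧v-⊢ t)
  ⟦⟧c-⊢ (tlet t u)    = tlet (⟦⟧c-⊢ t) (⟦⟧c-⊢ u)
  ⟦⟧c-⊢ (tapp t u)    = tapp (⟦⟧v-⊢ t) (⟦⟧v-⊢ u)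
  ⟦⟧c-⊢ (tcase t u v) =
    tlet (thandle (tapp (⟦⟧v-⊢ t) tunit) caseRet-⊢ caseOp-⊢)
      (tlet (tapp (tvar here) (tlam (renHC-⊢ (liftR-typed there) (⟦⟧c-⊢ v))))
            (tapp (tvar here) (tlam (renHC-⊢ (there ∘ there ∘ there) (⟦⟧c-⊢ u)))))

wk³ : Ren
wk³ = suc ∘ suc ∘ suc

⟦case⟧ : HVal → HComp → HComp → HComp
⟦case⟧ W D′ C′ =
  lett (handle (app W unit) caseRet caseOp) (lett (app (var 0) (lam D′)) (app (var 0) (lam C′)))

succH-renHV : ∀ ρ W → renHV ρ (succH W) ≡ succH (renHV ρ W)
succH-renHV ρ W = cong (λ X → lam (op unit (app X unit))) (renHV-comm (λ i → refl) W)

succH-subHV : ∀ σ W → subHV σ (succH W) ≡ succH (subHV σ W)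
succH-subHV σ W =
  cong (λ X → lam (op unit (app X unit))) (sym (renHV-subHV-comm (λ i → sym (renHV-renHV suc suc (σ i))) W))

mutual
  ⟦⟧v-renPV : ∀ ρ V → ⟦ renPV ρ V ⟧v ≡ renHV ρ ⟦ V ⟧v
  ⟦⟧v-renPV ρ (var i)  = refl
  ⟦⟧v-renPV ρ zero     = refl
  ⟦⟧v-renPV ρ (succ V) = trans (cong succH (⟦⟧v-renPV ρ V)) (sym (succH-renHV ρ ⟦ V ⟧v))
  ⟦⟧v-renPV ρ (lam C)  = cong lam (⟦⟧c-renPC (liftR ρ) C)
  ⟦⟧v-renPV ρ (rec C)  = cong rec (⟦⟧c-renPC (liftR (liftR ρ)) C)

  ⟦⟧c-renPC : ∀ ρ C → ⟦ renPC ρ C ⟧c ≡ renHC ρ ⟦ C ⟧c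
  ⟦⟧c-renPC ρ (return V)   = cong return (⟦⟧v-renPV ρ V)
  ⟦⟧c-renPC ρ (lett C D)   = cong₂ lett (⟦⟧c-renPC ρ C) (⟦⟧c-renPC (liftR ρ) D)
  ⟦⟧c-renPC ρ (app V W)    = cong₂ app (⟦⟧v-renPV ρ V) (⟦⟧v-renPV ρ W)
  ⟦⟧c-renPC ρ (case V C D) = cong₃ ⟦case⟧ (⟦⟧v-renPV ρ V)
    (trans (cong (renHC (liftR suc)) (⟦⟧c-renPC (liftR ρ) D))
           (renHC-comm (λ { zero → refl ; (suc i) → refl }) ⟦ D ⟧c))
    (trans (cong (renHC wk³) (⟦⟧c-renPC ρ C)) (renHC-comm (λ i → refl) ⟦ C ⟧c))

⟦⟧v-liftPS : ∀ (s : PSub) i → ⟦ liftPS s i ⟧v ≡ liftHS (⟦_⟧v ∘ s) i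
⟦⟧v-liftPS s zero    = refl
⟦⟧v-liftPS s (suc i) = ⟦⟧v-renPV suc (s i)

mutual
  ⟦⟧v-subPV : ∀ s V → ⟦ subPV s V ⟧v ≡ subHV (⟦_⟧v ∘ s) ⟦ V ⟧v
  ⟦⟧v-subPV s (var i)  = refl
  ⟦⟧v-subPV s zero     = refl
  ⟦⟧v-subPV s (succ V) = trans (cong succH (⟦⟧v-subPV s V)) (sym (succH-subHV (⟦_⟧v ∘ s) ⟦ V ⟧v))
  ⟦⟧v-subPV s (lam C)  =
    cong lam (trans (⟦⟧c-subPC (liftPS s) C) (subHC-cong (⟦⟧v-liftPS s) ⟦ C ⟧c))
  ⟦⟧v-subPV s (rec C)  = cong rec (trans (⟦⟧c-subPC (liftPS (liftPS s)) C)
    (subHC-cong (λ i → trans (⟦⟧v-liftPS (liftPS s) i) (liftHS-cong (⟦⟧v-liftPS s) i)) ⟦ C ⟧c))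

  ⟦⟧c-subPC : ∀ s C → ⟦ subPC s C ⟧c ≡ subHC (⟦_⟧v ∘ s) ⟦ C ⟧c
  ⟦⟧c-subPC s (return V)   = cong return (⟦⟧v-subPV s V)
  ⟦⟧c-subPC s (lett C D)   =
    cong₂ lett (⟦⟧c-subPC s C) (trans (⟦⟧c-subPC (liftPS s) D) (subHC-cong (⟦⟧v-liftPS s) ⟦ D ⟧c))
  ⟦⟧c-subPC s (app V W)    = cong₂ app (⟦⟧v-subPV s V) (⟦⟧v-subPV s W)
  ⟦⟧c-subPC s (case V C D) = cong₃ ⟦case⟧ (⟦⟧v-subPV s V)
    (trans (cong (renHC (liftR suc))
                 (trans (⟦⟧c-subPC (liftPS s) D) (subHC-cong (⟦⟧v-liftPS s) ⟦ D ⟧c)))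
           (renHC-subHC-comm (λ { zero → refl ; (suc i) → renHV-comm (λ j → refl) (⟦ s i ⟧v) }) ⟦ D ⟧c))
    (trans (cong (renHC wk³) (⟦⟧c-subPC s C))
           (renHC-subHC-comm (λ i → sym (wk-wk-wk ⟦ s i ⟧v)) ⟦ C ⟧c))
    where
    wk-wk-wk : ∀ X → renHV suc (renHV suc (renHV suc X)) ≡ renHV wk³ X
    wk-wk-wk X = trans (cong (renHV suc) (renHV-renHV suc suc X)) (renHV-renHV suc (suc ∘ suc) X)

⟦⟧c-[]p : ∀ D V → ⟦ D [ V ]p ⟧c ≡ ⟦ D ⟧c [ ⟦ V ⟧v ]h
⟦⟧c-[]p D V = trans (⟦⟧c-subPC _ D) (subHC-cong (λ { zero → refl ; (suc i) → refl }) ⟦ D ⟧c)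

⟦⟧c-[∣]p : ∀ D V W → ⟦ D [ V ∣ W ]p ⟧c ≡ ⟦ D ⟧c [ ⟦ V ⟧v ∣ ⟦ W ⟧v ]h
⟦⟧c-[∣]p D V W =
  trans (⟦⟧c-subPC _ D) (subHC-cong (λ { zero → refl ; (suc zero) → refl ; (suc (suc i)) → refl }) ⟦ D ⟧c)

lam-closed : ∀ {C B} → [] ⊢hc C ∶ B → Closed (lam C)
lam-closed t = (λ σ → cong lam (subHC-id (λ ()) t)) , (λ ρ → cong lam (renHC-id (λ ()) t))

⟦num⟧-closed : ∀ n → Closed ⟦ num n ⟧v
⟦num⟧-closed n = ⊢hv-closed (⟦⟧v-⊢ (num-⊢ n))

_⟶h⁺_ : HComp → HComp → Set
C ⟶h⁺ C″ = Σ HComp λ C′ → (C ⟶h C′) × (C′ ⟶h* C″)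

⟶h⁺⇒⟶h* : ∀ {C C′} → C ⟶h⁺ C′ → C ⟶h* C′
⟶h⁺⇒⟶h* (_ , r , rs) = r ◅ rs

⟶h⁺-◅◅ : ∀ {C C′ C″} → C ⟶h⁺ C′ → C′ ⟶h* C″ → C ⟶h⁺ C″
⟶h⁺-◅◅ (_ , r , rs) rs′ = _ , r , (rs ◅◅ rs′)

⟶h-≡ : ∀ {C C′ C″} → C ⟶h C′ → C′ ≡ C″ → C ⟶h C″
⟶h-≡ r refl = r

lett-⟶h* : ∀ {C C′ D} → C ⟶h* C′ → lett C D ⟶h* lett C′ D
lett-⟶h* ε        = ε
lett-⟶h* (r ◅ rs) = ξ-let r ◅ lett-⟶h* rs

lett-⟶h⁺ : ∀ {C C′ D} → C ⟶h⁺ C′ → lett C D ⟶h⁺ lett C′ D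
lett-⟶h⁺ (_ , r , rs) = _ , ξ-let r , lett-⟶h* rs

renHV²-closed : ∀ {W} → Closed W → ∀ ρ τ → renHV ρ (renHV τ W) ≡ W
renHV²-closed c ρ τ = trans (cong (renHV ρ) (proj₂ c τ)) (proj₂ c ρ)

weaken-closed : ∀ {W} → Closed W → ∀ k → iterate (renHV suc) W k ≡ W
weaken-closed c zero    = refl
weaken-closed c (suc k) = trans (cong (λ X → iterate (renHV suc) X k) (proj₂ c suc)) (weaken-closed c k)

resume : HVal → HVal
resume W = lam (handle (app W unit) caseRet caseOp)

caseOpBody : HVal → HVal → HVal → HComp
caseOpBody R S S′ =
  lett (app R unit) (lett (app (var 0) (lam (app S (succH (var 0))))) (app (var 0) (lam (app S′ zeroH))))

-- In handled (suc m), var 3 and var 4 both denote the successor branch s; the zero branch is unused.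
handled : ℕ → HVal
handled zero    = lam (return (lam (app (var 0) unit)))
handled (suc m) = lam (return (lam (caseOpBody (resume ⟦ num m ⟧v) (var 3) (var 4))))

handle-num : ∀ n → handle (app ⟦ num n ⟧v unit) caseRet caseOp ⟶h⁺ return (handled n)
handle-num zero    = _ , ξ-handle β-lam , (β-hret ◅ ε)
handle-num (suc m) = _ ,
    ξ-handle (⟶h-≡ β-lam (cong (λ X → op unit (app X unit)) (trans (cong (subHV _) (proj₂ c _)) (proj₁ c _)))) ,
    (⟶h-≡ β-hop (cong (λ X → return (lam (return (lam (caseOpBody (resume X) (var 3) (var 4))))))
                      (renHV²-closed c _ _)) ◅ ε)
  where c = ⟦num⟧-closed m

selected : ℕ → HVal → HVal → HComp
selected zero    S Z = app Z unit
selected (suc m) S Z = app S ⟦ num m ⟧v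

succBranch : HVal → HVal
succBranch S = lam (app S (succH (var 0)))

zeroBranch : HVal → HVal
zeroBranch S = lam (app S zeroH)

succBranch-closed : ∀ {S} → Closed S → Closed (succBranch S)
succBranch-closed c = (λ σ → cong (λ X → lam (app X (succH (var 0)))) (proj₁ c _)) ,
                      (λ ρ → cong (λ X → lam (app X (succH (var 0)))) (proj₂ c _))

zeroBranch-closed : ∀ {S} → Closed S → Closed (zeroBranch S)
zeroBranch-closed c = (λ σ → cong (λ X → lam (app X zeroH)) (proj₁ c _)) ,
                      (λ ρ → cong (λ X → lam (app X zeroH)) (proj₂ c _))

selected-shift : ∀ m S → Closed S →
                 selected m (succBranch S) (zeroBranch S) ⟶h* selected (suc m) S (zeroBranch S)
selected-shift zero    S c = ⟶h-≡ β-lam (cong (λ X → app X zeroH) (proj₁ c _)) ◅ ε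
selected-shift (suc m) S c = ⟶h-≡ β-lam (cong₂ (λ X Y → app X (lam (op unit (app Y unit))))
    (proj₁ c _) (trans (renHV²-closed cW _ _) (sym (proj₂ cW _)))) ◅ ε
  where cW = ⟦num⟧-closed m

-- The deep handler for succ(m) re-handles the thunk ⟦ num m ⟧v and wraps the successor
-- branch in succBranch, so by induction the branch S receives exactly ⟦ num m ⟧v.
apply-handled : ∀ n S Z → Closed S → Closed Z → lett (app (handled n) S) (app (var 0) Z) ⟶h* selected n S Z
apply-handled zero S Z cS cZ =
  ξ-let β-lam ◅ ⟶h-≡ β-let (cong (app (lam (app (var 0) unit))) (proj₁ cZ _)) ◅ β-lam ◅ ε
apply-handled (suc m) S Z cS cZ =
  ξ-let (⟶h-≡ β-lam (cong₃ (λ X Y Y′ → return (lam (caseOpBody (resume X) Y Y′)))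
                           (proj₁ cW _) (weaken-closed cS 3) (weaken-closed cS 4))) ◅
  ⟶h-≡ β-let (cong (app (lam (caseOpBody (resume W) S S))) (proj₁ cZ _)) ◅
  ⟶h-≡ β-lam (cong₃ (λ X Y Y′ → caseOpBody (resume X) Y Y′) (proj₁ cW _) (proj₁ cS _) (proj₁ cS _)) ◅
  ξ-let (⟶h-≡ β-lam (cong (λ X → handle (app X unit) caseRet caseOp) (proj₁ cW _))) ◅
  (lett-⟶h* (⟶h⁺⇒⟶h* (handle-num m)) ◅◅
  (⟶h-≡ β-let (cong₂ (λ X Y → lett (app (handled m) (lam (app X (succH (var 0))))) (app (var 0) (lam (app Y zeroH))))
                     (proj₁ cS _) (proj₁ cS _)) ◅
  (apply-handled m (succBranch S) (zeroBranch S) (succBranch-closed cS) (zeroBranch-closed cS) ◅◅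
   selected-shift m S cS)))
  where W  = ⟦ num m ⟧v
        cW = ⟦num⟧-closed m

caseReduct : ℕ → PComp → PComp → PComp
caseReduct zero    C D = C
caseReduct (suc m) C D = D [ num m ]p

case-num-sim : ∀ n {B C D} → [] ⊢pc C ∶ B → (Nat ∷ []) ⊢pc D ∶ B →
               ⟦ case (num n) C D ⟧c ⟶h⁺ ⟦ caseReduct n C D ⟧c
case-num-sim n {C = C} {D} tC tD =
  ⟶h⁺-◅◅ (lett-⟶h⁺ (handle-num n))
    (⟶h-≡ β-let (cong₂ (λ X Y → lett (app (handled n) (lam X)) (app (var 0) (lam Y))) D-fixed C-fixed) ◅
     (apply-handled n (lam ⟦ D ⟧c) (lam ⟦ C ⟧c) (⊢hv-closed (tlam ⟦D⟧-⊢)) (lam-closed ⟦C⟧-⊢) ◅◅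
      select n))
  where
  ⟦C⟧-⊢ = ⟦⟧c-⊢ tC
  ⟦D⟧-⊢ = ⟦⟧c-⊢ tD
  D-fixed = trans (subHC-renHC _ _ ⟦ D ⟧c) (subHC-id (λ { here → refl ; (there ()) }) ⟦D⟧-⊢)
  C-fixed = trans (subHC-renHC _ _ ⟦ C ⟧c) (subHC-id (λ ()) ⟦C⟧-⊢)
  select : ∀ n → selected n (lam ⟦ D ⟧c) (lam ⟦ C ⟧c) ⟶h* ⟦ caseReduct n C D ⟧c
  select zero    = ⟶h-≡ β-lam (subHC-id (λ ()) ⟦C⟧-⊢) ◅ ε
  select (suc m) = ⟶h-≡ β-lam (sym (⟦⟧c-[]p D (num m))) ◅ ε

simulation : ∀ {C C′ A} → [] ⊢pc C ∶ A → C ⟶p C′ → ⟦ C ⟧c ⟶h⁺ ⟦ C′ ⟧c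
simulation {lett (return V) D} _ β-let = _ , ⟶h-≡ β-let (sym (⟦⟧c-[]p D V)) , ε
simulation (tlet t _) (ξ-let r)        = lett-⟶h⁺ (simulation t r)
simulation {app (lam C) V} _ β-lam     = _ , ⟶h-≡ β-lam (sym (⟦⟧c-[]p C V)) , ε
simulation {app (rec C) V} _ β-rec     = _ , ⟶h-≡ β-rec (sym (⟦⟧c-[∣]p C V (rec C))) , ε
simulation (tcase _ u v) β-zero        = case-num-sim zero u v
simulation (tcase (tsucc w) u v) β-succ with canonical-Nat w
... | m , refl = case-num-sim (suc m) u v

simulation* : ∀ {C C′ A} → [] ⊢pc C ∶ A → C ⟶p* C′ → ⟦ C ⟧c ⟶h* ⟦ C′ ⟧c
simulation* t ε        = ε
simulation* t (r ◅ rs) = ⟶h⁺⇒⟶h* (simulation t r) ◅◅ simulation* (preservation t r) rs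

⟶h[]-shorten : ∀ {C C″ k} → C ⟶h[ suc k ] C″ → Σ HComp λ C′ → C ⟶h[ k ] C′
⟶h[]-shorten (step r done)         = _ , done
⟶h[]-shorten (step r (step r′ rs)) with ⟶h[]-shorten (step r′ rs)
... | C′ , rs′ = C′ , step r rs′

⟶h*-extend-path : ∀ {C C′} → C ⟶h* C′ → ∀ k → Σ HComp (C′ ⟶h[ k ]_) → Σ HComp (C ⟶h[ k ]_)
⟶h*-extend-path ε        k       path = path
⟶h*-extend-path (r ◅ rs) zero    path = _ , done
⟶h*-extend-path (r ◅ rs) (suc k) path with ⟶h*-extend-path rs (suc k) path
... | _ , rs′ with ⟶h[]-shorten rs′
...   | C″ , rs″ = C″ , step r rs″

ET-⟶h* : ∀ {C C′ t} → C ⟶h* C′ → ET C′ ≡ t → ET C ≡ t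
ET-⟶h* rs (et-ret rs′)   = et-ret (rs ◅◅ rs′)
ET-⟶h* rs (et-op rs′ et) = et-op (rs ◅◅ rs′) et
ET-⟶h* rs (et-div d)     = et-div (λ k → ⟶h*-extend-path rs k (d k))

ET-num : ∀ n → ET (app ⟦ num n ⟧v unit) ≡ natTree n
ET-num zero    = et-ret (β-lam ◅ ε)
ET-num (suc m) = et-op (β-lam ◅ ε) (subst (λ X → ET app X unit ≡ natTree m) (sym W-fixed) (ET-num m))
  where
  c = ⟦num⟧-closed m
  W-fixed = trans (cong (subHV _) (trans (cong (subHV _) (proj₂ c _)) (proj₁ c _))) (proj₁ c _)

lett-⟶h[] : ∀ {C C′ D k} → C ⟶h[ k ] C′ → lett C D ⟶h[ k ] lett C′ D
lett-⟶h[] done        = done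
lett-⟶h[] (step r rs) = step (ξ-let r) (lett-⟶h[] rs)

lett-diverges : ∀ {C D} → Diverges C → Diverges (lett C D)
lett-diverges d k with d k
... | C′ , rs = lett C′ _ , lett-⟶h[] rs

⟦⟧-diverges : ∀ {C A} → [] ⊢pc C ∶ A → ¬ Σ PVal (λ V → C ⟶p* return V) → Diverges ⟦ C ⟧c
⟦⟧-diverges t ¬halts zero = _ , done
⟦⟧-diverges t ¬halts (suc k) with progress t
... | inj₁ (V , refl) = ⊥-elim (¬halts (V , ε))
... | inj₂ (C′ , r) with simulation t r
...   | _ , s , ss with ⟶h*-extend-path ss k
                         (⟦⟧-diverges (preservation t r) (λ { (V , rs) → ¬halts (V , r ◅ rs) }) k)
...     | C″ , rs = C″ , step s rs

halts-num : ∀ {C} → [] ⊢pc C ∶ Nat →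
            Σ PVal (λ V → C ⟶p* return V) → Σ ℕ (λ n → C ⟶p* return (num n))
halts-num t (_ , rs) with preservation* t rs
... | treturn v with canonical-Nat v
...   | n , refl = n , rs

theorem8p10 : (C : PComp) → [] ⊢pc C ∶ Nat →
    ([] ⊢hc Cf C ∶ Unit)
    × ((n : ℕ) → C ⟶p* return (num n) → ET Cf C ≡ natTree n)
    × ((¬ Σ ℕ (λ n → C ⟶p* return (num n))) → ET Cf C ≡ ⊥t)
theorem8p10 C t =
  tlet (⟦⟧c-⊢ t) (tapp (tvar here) tunit) ,
  (λ n rs → ET-⟶h* (lett-⟶h* (simulation* t rs) ◅◅ (β-let ◅ ε)) (ET-num n)) ,
  (λ ¬halts → et-div (lett-diverges (⟦⟧-diverges t (¬halts ∘ halts-num t))))
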